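{- Let $(F_n)_{n\ge0}$ be the Fibonacci sequence with $F_0=1$, $F_1=2$, $F_n=F_{n-1}+F_{n-2}$. The only powers of two whose Zeckendorf expansion has exactly three non-zero digits (summands) are $32,64,128,256$ and $1024$. Moreover, there is no power of two whose Zeckendorf expansion has exactly four non-zero digits.
   Context: The Zeckendorf expansion of a positive integer $n$ is its unique representation $n=F_{n_1}+\dots+F_{n_k}$ with $n_1>\dots>n_k\ge0$ and $n_i-n_{i+1}\ge2$ for all $i$; its number of non-zero digits is $k$. -}

module Defs where

open import Data.Nat using (ℕ; zero; suc; _+_; _≤_; _<_)
open import Relation.Binary.PropositionalEquality using (_≡_)
open import Data.List using (List; []; _∷_; map)
open import Data.Nat.ListAction using (sum)

F : ℕ → ℕ
F 0 = 1
F 1 = 2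
F (suc (suc n)) = F (suc n) + F n

data ZeckIndices : List ℕ → Set where
  [] : ZeckIndices []
  [_] : (a : ℕ) → ZeckIndices (a ∷ [])
  _∷⟨_⟩_ : ∀ {b bs} (a : ℕ) → b + 2 ≤ a → ZeckIndices (b ∷ bs) → ZeckIndices (a ∷ b ∷ bs)

record IsZeckendorfExpansion (n : ℕ) (L : List ℕ) : Set where
  constructor zeck
  field
    indices : ZeckIndices L
    sums    : sum (map F L) ≡ n

{-# OPTIONS --safe #-}

-- A sum of four Fibonacci numbers, 0 allowed, is never 2 ^ k with k ≥ 11, and the obstruction is local:
-- the equation has no solution when the indices are taken modulo 15360 and k − 11 modulo 38400. Residue
-- classes are refined step by step, and after each step those are discarded which violate the equation
-- modulo some m for which the Fibonacci sequence and the powers of 2 are periodic in the current moduli.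
-- The solutions with k ≤ 10, also those with negative indices, survive every odd m; but 2 ^ k vanishes
-- modulo 2048 for k ≥ 11, so that the powers of two among the m remove them. Expansions of 2 ^ k with
-- k ≤ 10 are enumerated.
module Submission where

open import Defs
open import Data.Nat using (ℕ; _^_)
open import Data.List using (List; length)
open import Data.Product using (Σ; _×_; _,_)
open import Data.Sum using (_⊎_)
open import Relation.Binary.PropositionalEquality using (_≡_)
open import Relation.Nullary using (¬_)
open import Function.Bundles using (_⇔_)

open import Data.Bool using (Bool; true; false; if_then_else_; T; _∧_)
open import Data.Bool.ListAction using (all)
open import Data.Bool.Properties using (T-∧; T-≡)
open import Data.Empty using (⊥-elim)
open import Data.List using ([]; _∷_; _++_; map; iterate; upTo; cartesianProductWith)
open import Data.List.Membership.Propositional using (_∈_)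
open import Data.List.Membership.Propositional.Properties using (∈-++⁺ˡ; ∈-++⁺ʳ; ∈-map⁺; ∈-upTo⁺)
open import Data.List.Properties using (length-map)
open import Data.List.Relation.Binary.Permutation.Propositional using (_↭_; ↭-refl; ↭-trans; prep; swap)
open import Data.List.Relation.Binary.Permutation.Propositional.Properties using (map⁺)
open import Data.List.Relation.Binary.Pointwise as Pointwise using (Pointwise; []; _∷_)
open import Data.List.Relation.Unary.All as All using (All)
open import Data.List.Relation.Unary.All.Properties using (all⁺)
open import Data.List.Relation.Unary.Any as Any using (Any; here; there)
import Data.List.Relation.Unary.Any.Properties as Any
open import Data.Nat using (zero; suc; _+_; _*_; _∸_; _≤_; _<_; _≡ᵇ_; _≟_; _≤?_; NonZero; z≤n; s≤s)
open import Data.Nat.DivMod using (_/_; _%_; m≡m%n+[m/n]*n; m%n<n; %-distribˡ-+; %-distribˡ-*)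
open import Data.Nat.GeneralisedArithmetic using (fold)
open import Data.Nat.ListAction using (sum)
open import Data.Nat.ListAction.Properties using (sum-↭)
open import Data.Nat.Properties
open import Data.Nat.Tactic.RingSolver using (solve-∀)
open import Data.Product using (∃; proj₂)
open import Data.Sum using (inj₁; inj₂)
open import Data.Unit using (tt)
open import Function using (_∘_; Equivalence; mk⇔)
open import Relation.Binary.PropositionalEquality using (_≢_; refl; sym; trans; cong; cong₂; subst; module ≡-Reasoning)
open import Relation.Nullary using (Dec; yes; no; ¬?)
open import Relation.Nullary.Decidable using (True; toWitness; _⊎-dec_; _→-dec_)

-- Choices and multisets of residue classes.

choices : ∀ {A : Set} → List (List A) → List (List A)
choices [] = [] ∷ []
choices (ys ∷ yss) = cartesianProductWith _∷_ ys (choices yss)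

choices⁺ : ∀ {A B : Set} {R : A → B → Set} {xs yss} →
  Pointwise (λ x → Any (R x)) xs yss → Any (Pointwise R xs) (choices yss)
choices⁺ [] = here []
choices⁺ (p ∷ ps) = Any.cartesianProductWith⁺ _∷_ _∷_ p (choices⁺ ps)

multisets : ∀ {A : Set} → ℕ → List A → List (List A)
multisets zero zs = [] ∷ []
multisets (suc n) [] = []
multisets (suc n) (z ∷ zs) = map (z ∷_) (multisets n (z ∷ zs)) ++ multisets (suc n) zs

module _ {A B : Set} {R : A → B → Set} where

  -- Insertion sort by position in `zs`: `multisets` keeps entries in the order of `zs`, so `x`
  -- moves past every entry matched with an earlier element and is placed before the rest.
  multisets-insert : ∀ n zs {x xs} → Any (R x) zs → Any (Pointwise R xs) (multisets n zs) →
    ∃ λ ys → ys ↭ x ∷ xs × Any (Pointwise R ys) (multisets (suc n) zs)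
  multisets-insert n (z ∷ zs) (here r) c =
    _ , ↭-refl , Any.++⁺ˡ (Any.map⁺ (Any.map (r ∷_) c))
  multisets-insert zero (z ∷ zs) (there i) (here []) =
    let ys , p , d = multisets-insert zero zs i (here []) in ys , p , Any.++⁺ʳ _ d
  multisets-insert (suc n) (z ∷ zs) {x} {xs} (there i) c
    with Any.++⁻ (map (z ∷_) (multisets n (z ∷ zs))) c
  ... | inj₂ c′ = let ys , p , d = multisets-insert (suc n) zs i c′ in ys , p , Any.++⁺ʳ _ d
  ... | inj₁ c′ with xs | Any.map⁻ c′
  ... | [] | c″ with Any.satisfied c″
  ... | _ , ()
  multisets-insert (suc n) (z ∷ zs) {x} (there i) c | inj₁ c′ | y ∷ xs | c″ =
    let ys , p , d = multisets-insert n (z ∷ zs) (there i) (Any.map Pointwise.tail c″)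
        r = Pointwise.head (proj₂ (Any.satisfied c″))
    in y ∷ ys , ↭-trans (prep y p) (swap y x ↭-refl) , Any.++⁺ˡ (Any.map⁺ (Any.map (r ∷_) d))

  multisets⁺ : ∀ zs → (∀ x → Any (R x) zs) → ∀ xs →
    ∃ λ ys → ys ↭ xs × Any (Pointwise R ys) (multisets (length xs) zs)
  multisets⁺ zs h [] = [] , ↭-refl , here []
  multisets⁺ zs h (x ∷ xs) =
    let ys , p , c = multisets⁺ zs h xs
        ys′ , p′ , c′ = multisets-insert (length xs) zs (h x) c
    in ys′ , ↭-trans p′ (prep x p) , c′

-- Arithmetic progressions represented by powers.

module Progression {A : Set} (_∙_ : A → A → A) (pow : ℕ → A)
  (pow-+ : ∀ m n → pow (m + n) ≡ pow m ∙ pow n) where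

  -- The class is represented by the value `pow start` instead of `start`, so that the search
  -- multiplies powers and never recomputes them from exponents.
  record _∈⟨_mod_⟩ (x : ℕ) (z : A) (N : ℕ) : Set where
    constructor progression
    field
      start quotient : ℕ
      index≡ : x ≡ start + quotient * N
      power≡ : z ≡ pow start

  trivial : ∀ x → x ∈⟨ pow 0 mod 1 ⟩
  trivial x = progression 0 x (sym (*-identityʳ x)) refl

  -- Identifies the multiplier that the search computes by `fold` with the power belonging to the
  -- new modulus `n * N`.
  fold-pow : ∀ N n → fold (pow 0) (pow N ∙_) n ≡ pow (n * N)
  fold-pow N zero = refl
  fold-pow N (suc n) = trans (cong (pow N ∙_) (fold-pow N n)) (sym (pow-+ N (n * N)))

  iterate-pow : ∀ N n e r → e < n → Any (_≡ pow (e * N + r)) (iterate (pow N ∙_) (pow r) n)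
  iterate-pow N (suc n) zero r _ = here refl
  iterate-pow N (suc n) (suc e) r (s≤s e<n)
    rewrite sym (pow-+ N r) =
      there (Any.map (λ p → trans p (cong pow (lemma e N r))) (iterate-pow N n e (N + r) e<n))
    where
    lemma : ∀ e N r → e * N + (N + r) ≡ N + e * N + r
    lemma = solve-∀

  refine : ∀ {N x z} n .{{_ : NonZero n}} → x ∈⟨ z mod N ⟩ →
    Any (λ z′ → x ∈⟨ z′ mod n * N ⟩) (iterate (pow N ∙_) z n)
  -- The residue of the quotient `q` modulo `n` selects one of the `n` subclasses modulo `n * N`.
  refine {N} n (progression r q refl refl) =
    Any.map (progression ((q % n) * N + r) (q / n) eq) (iterate-pow N n (q % n) r (m%n<n q n))
    where
    lemma : ∀ r e d n N → r + (e + d * n) * N ≡ e * N + r + d * (n * N)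
    lemma = solve-∀
    eq : r + q * N ≡ (q % n) * N + r + (q / n) * (n * N)
    eq = trans (cong (λ h → r + h * N) (m≡m%n+[m/n]*n q n)) (lemma r (q % n) (q / n) n N)

-- Congruences.

infix 4 _≡_[mod_]
_≡_[mod_] : ℕ → ℕ → (m : ℕ) .{{_ : NonZero m}} → Set
a ≡ b [mod m ] = a % m ≡ b % m

module _ (m : ℕ) .{{_ : NonZero m}} {a a′ b b′ : ℕ} where

  +-cong-mod : a ≡ a′ [mod m ] → b ≡ b′ [mod m ] → a + b ≡ a′ + b′ [mod m ]
  +-cong-mod p q = trans (%-distribˡ-+ a b m)
    (trans (cong₂ (λ x y → (x + y) % m) p q) (sym (%-distribˡ-+ a′ b′ m)))

  *-cong-mod : a ≡ a′ [mod m ] → b ≡ b′ [mod m ] → a * b ≡ a′ * b′ [mod m ]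
  *-cong-mod p q = trans (%-distribˡ-* a b m)
    (trans (cong₂ (λ x y → (x * y) % m) p q) (sym (%-distribˡ-* a′ b′ m)))

-- Fibonacci numbers from powers of φ.

infixl 7 _∙_
infix 5 _+φ_

-- a +φ b stands for a + bφ with φ² = φ + 1; φ ^ n has golden part the n-th Fibonacci number
-- in the usual numbering 0, 1, 1, 2, …, so that F n belongs to φ ^ (n + 2).
record ℕ[φ] : Set where
  constructor _+φ_
  field
    rational golden : ℕ
open ℕ[φ]

_∙_ : ℕ[φ] → ℕ[φ] → ℕ[φ]
(a +φ b) ∙ (c +φ d) = a * c + b * d +φ a * d + b * c + b * d

∙-assoc : ∀ x y z → (x ∙ y) ∙ z ≡ x ∙ (y ∙ z)
∙-assoc (a +φ b) (c +φ d) (e +φ f) = cong₂ _+φ_ (rat a b c d e f) (gold a b c d e f)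
  where
  rat : ∀ a b c d e f → (a * c + b * d) * e + (a * d + b * c + b * d) * f
    ≡ a * (c * e + d * f) + b * (c * f + d * e + d * f)
  rat = solve-∀
  gold : ∀ a b c d e f →
    (a * c + b * d) * f + (a * d + b * c + b * d) * e + (a * d + b * c + b * d) * f
    ≡ a * (c * f + d * e + d * f) + b * (c * e + d * f) + b * (c * f + d * e + d * f)
  gold = solve-∀

∙-identityˡ : ∀ x → (1 +φ 0) ∙ x ≡ x
∙-identityˡ (c +φ d) = cong₂ _+φ_ (rat c) (gold d)
  where
  rat : ∀ c → 1 * c + 0 ≡ c
  rat = solve-∀
  gold : ∀ d → 1 * d + 0 + 0 ≡ d
  gold = solve-∀

infixr 8 φ^_
φ^_ : ℕ → ℕ[φ]
φ^ n = fold (1 +φ 0) ((0 +φ 1) ∙_) n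

φ^-+ : ∀ m n → φ^ (m + n) ≡ φ^ m ∙ φ^ n
φ^-+ zero n = sym (∙-identityˡ (φ^ n))
φ^-+ (suc m) n = trans (cong ((0 +φ 1) ∙_) (φ^-+ m n)) (sym (∙-assoc (0 +φ 1) (φ^ m) (φ^ n)))

fib : ℕ → ℕ
fib n = golden (φ^ n)

fib-rec : ∀ n → fib (2 + n) ≡ fib (1 + n) + fib n
fib-rec n = lemma (rational (φ^ n)) (fib n)
  where
  lemma : ∀ a b → 1 * (1 * b) + 1 * (1 * a + 1 * b) ≡ 1 * a + 1 * b + b
  lemma = solve-∀

F≡fib : ∀ n → F n ≡ fib (2 + n)
F≡fib 0 = refl
F≡fib 1 = refl
F≡fib (suc (suc n)) = trans (cong₂ _+_ (F≡fib (suc n)) (F≡fib n)) (sym (fib-rec (2 + n)))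

module Index = Progression _∙_ φ^_ φ^-+
module Exponent = Progression _*_ (2 ^_) (^-distribˡ-+-* 2)
open Index using (_∈⟨_mod_⟩)

-- Periodicity modulo m.

module _ (m : ℕ) .{{_ : NonZero m}} where

  -- The two hypotheses say that φ ^ N is 1 modulo m in both components, so multiplying by it leaves
  -- golden parts unchanged modulo m.
  fib-periodic : ∀ {N} → rational (φ^ N) ≡ 1 [mod m ] → fib N ≡ 0 [mod m ] →
    ∀ q r → fib (q * N + r) ≡ fib r [mod m ]
  fib-periodic p₁ p₀ zero r = refl
  fib-periodic {N} p₁ p₀ (suc q) r = begin
    fib (N + q * N + r) % m      ≡⟨ cong (λ h → fib h % m) (+-assoc N (q * N) r) ⟩
    fib (N + s) % m              ≡⟨ cong (λ h → golden h % m) (φ^-+ N s) ⟩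
    (a * d + b * c + b * d) % m  ≡⟨ +-cong-mod m (+-cong-mod m (*-cong-mod m p₁ refl) (*-cong-mod m p₀ refl)) (*-cong-mod m p₀ refl) ⟩
    (1 * d + 0 + 0) % m          ≡⟨ cong (_% m) (lemma d) ⟩
    fib s % m                    ≡⟨ fib-periodic p₁ p₀ q r ⟩
    fib r % m                    ∎
    where
    open ≡-Reasoning
    s = q * N + r
    a = rational (φ^ N)
    b = fib N
    c = rational (φ^ s)
    d = fib s
    lemma : ∀ d → 1 * d + 0 + 0 ≡ d
    lemma = solve-∀

  -- For even m the hypothesis can hold only because of the factor c, later 2 ^ 11.
  power-periodic : ∀ c {L} → c * 2 ^ L ≡ c [mod m ] →
    ∀ q r → c * 2 ^ (q * L + r) ≡ c * 2 ^ r [mod m ]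
  power-periodic c p zero r = refl
  power-periodic c {L} p (suc q) r = begin
    (c * 2 ^ (L + q * L + r)) % m  ≡⟨ cong (λ h → (c * 2 ^ h) % m) (+-assoc L (q * L) r) ⟩
    (c * 2 ^ (L + s)) % m          ≡⟨ cong (λ h → (c * h) % m) (^-distribˡ-+-* 2 L s) ⟩
    (c * (2 ^ L * 2 ^ s)) % m      ≡⟨ cong (_% m) (sym (*-assoc c (2 ^ L) (2 ^ s))) ⟩
    (c * 2 ^ L * 2 ^ s) % m        ≡⟨ *-cong-mod m p refl ⟩
    (c * 2 ^ s) % m                ≡⟨ power-periodic c p q r ⟩
    (c * 2 ^ r) % m                ∎
    where
    open ≡-Reasoning
    s = q * L + r

  sum-fib-mod : ∀ {N xs zs} → rational (φ^ N) ≡ 1 [mod m ] → fib N ≡ 0 [mod m ] →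
    Pointwise (λ x z → x ∈⟨ z mod N ⟩) xs zs → sum (map golden zs) ≡ sum (map fib xs) [mod m ]
  sum-fib-mod p₁ p₀ [] = refl
  sum-fib-mod {N} p₁ p₀ (Index.progression r q refl refl ∷ cs) =
    +-cong-mod m
      (sym (trans (cong (λ h → fib h % m) (+-comm r (q * N))) (fib-periodic p₁ p₀ q r)))
      (sum-fib-mod p₁ p₀ cs)

-- The search and its soundness.

data Step : Set where
  index exponent sieve : (n : ℕ) .{{_ : NonZero n}} → Step

-- A node of the search consists of P = φ ^ N and Q = 2 ^ L for the current moduli N of the indices
-- and L of the exponent, and of the powers zs of φ and t of 2 at representatives of the classes.
refuted : List Step → ℕ[φ] → ℕ → List ℕ[φ] → ℕ → Bool
refuted [] P Q zs t = false
refuted (index n ∷ S) P Q zs t =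
  all (λ zs′ → refuted S (fold (φ^ 0) (P ∙_) n) Q zs′ t)
      (choices (map (λ z → iterate (P ∙_) z n) zs))
refuted (exponent n ∷ S) P Q zs t =
  all (refuted S P (fold 1 (Q *_) n) zs) (iterate (Q *_) t n)
refuted (sieve m ∷ S) P Q zs t =
  if sum (map golden zs) % m ≡ᵇ (2048 * t) % m then refuted S P Q zs t else true

-- The periodicity hypotheses of all sieves. They depend on the moduli alone, not on the classes, so
-- one run along the steps checks them for every branch.
periodic : List Step → ℕ[φ] → ℕ → Bool
periodic [] P Q = true
periodic (index n ∷ S) P Q = periodic S (fold (φ^ 0) (P ∙_) n) Q
periodic (exponent n ∷ S) P Q = periodic S P (fold 1 (Q *_) n)
periodic (sieve m ∷ S) P Q =
  (rational P % m ≡ᵇ 1 % m) ∧ (golden P % m ≡ᵇ 0 % m) ∧ ((2048 * Q) % m ≡ᵇ 2048 % m)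
  ∧ periodic S P Q

lookup-all : ∀ {A : Set} (p : A → Bool) {Q : A → Set} xs →
  all p xs ≡ true → Any Q xs → ∃ λ x → T (p x) × Q x
lookup-all p xs eq q = _ , All.lookupAny (all⁺ p xs (Equivalence.from T-≡ eq)) q

-- Induction follows the branch whose classes contain `xs` and `k`. By periodicity a solution passes
-- each sieve there, so the branch would run out of steps, where `refuted` is `false`; hence the
-- empty list needs no clause.
refuted-sound : ∀ S N L {xs k zs t} → T (periodic S (φ^ N) (2 ^ L)) →
  Pointwise (λ x z → x ∈⟨ z mod N ⟩) xs zs → k Exponent.∈⟨ t mod L ⟩ →
  T (refuted S (φ^ N) (2 ^ L) zs t) → sum (map fib xs) ≢ 2048 * 2 ^ k
refuted-sound (index n ∷ S) N L per cs ce ref rewrite Index.fold-pow N n =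
  let zs′ , ref′ , cs′ = lookup-all _ _ (Equivalence.to T-≡ ref) (choices⁺ (refine-all cs))
  in refuted-sound S (n * N) L per cs′ ce ref′
  where
  refine-all : ∀ {xs zs} → Pointwise (λ x z → x ∈⟨ z mod N ⟩) xs zs →
    Pointwise (λ x → Any (λ z → x ∈⟨ z mod n * N ⟩)) xs (map (λ z → iterate (φ^ N ∙_) z n) zs)
  refine-all [] = []
  refine-all (c ∷ cs) = Index.refine n c ∷ refine-all cs
refuted-sound (exponent n ∷ S) N L per cs ce ref rewrite Exponent.fold-pow L n =
  let t′ , ref′ , ce′ = lookup-all _ _ (Equivalence.to T-≡ ref) (Exponent.refine n ce)
  in refuted-sound S N (n * L) per cs ce′ ref′
refuted-sound (sieve m ∷ S) N L {xs} {k} {zs} per cs ce@(Exponent.progression s q refl refl) ref eq =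
  let p₁ , per′ = Equivalence.to T-∧ per
      p₀ , per″ = Equivalence.to T-∧ per′
      p₂ , per‴ = Equivalence.to T-∧ per″
      golden-sum = sum-fib-mod m (≡ᵇ⇒≡ _ _ p₁) (≡ᵇ⇒≡ _ _ p₀) cs
      power = trans (cong (λ h → (2048 * 2 ^ h) % m) (+-comm s (q * L)))
                    (power-periodic m 2048 (≡ᵇ⇒≡ _ _ p₂) q s)
      passes = ≡⇒≡ᵇ _ _ (trans golden-sum (trans (cong (_% m) eq) power))
  in refuted-sound S N L per‴ cs ce (unfold (Equivalence.to T-≡ passes) ref) eq
  where
  unfold : ∀ {b c} → b ≡ true → T (if b then c else true) → T c
  unfold refl t = t

-- Found by computer search: each modulus m divides fib N and fib (N + 1) − 1 for the index modulus
-- N reached so far, and the order of 2 modulo the odd part of m divides the exponent modulus L.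
steps : List Step
steps =
    sieve 4
  ∷ index 5 ∷ exponent 5 ∷ sieve 31 ∷ exponent 2 ∷ sieve 11
  ∷ index 2 ∷ sieve 8 ∷ exponent 2 ∷ sieve 5 ∷ exponent 3 ∷ sieve 61
  ∷ index 2 ∷ sieve 16 ∷ sieve 3 ∷ sieve 41
  ∷ index 2 ∷ sieve 32 ∷ sieve 7 ∷ exponent 2 ∷ sieve 241
  ∷ index 2 ∷ sieve 64 ∷ exponent 10 ∷ sieve 1601
  ∷ index 2 ∷ sieve 128 ∷ exponent 8 ∷ sieve 769
  ∷ index 2 ∷ sieve 256 ∷ sieve 641
  ∷ index 2 ∷ sieve 512
  ∷ index 2 ∷ sieve 1024 ∷ exponent 2 ∷ sieve 7681
  ∷ index 2 ∷ sieve 2048 ∷ exponent 2 ∷ sieve 1689601 ∷ []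

periodic-steps : periodic steps (φ^ 6) (2 ^ 1) ≡ true
periodic-steps = refl

-- The equation is symmetric in the indices, so unordered residues modulo 6 suffice at the start.
residues : List ℕ[φ]
residues = iterate (φ^ 1 ∙_) (φ^ 0) 6

refutedAtStart : List ℕ[φ] → Bool
refutedAtStart zs = refuted steps (φ^ 6) (2 ^ 1) zs (2 ^ 0)

refuted-steps : all refutedAtStart (multisets 4 residues) ≡ true
refuted-steps = refl

four-fib≢power : ∀ xs k → length xs ≡ 4 → sum (map fib xs) ≢ 2048 * 2 ^ k
four-fib≢power xs k len eq =
  -- Refining the trivial class modulo 1 puts every index into one of the six residues; the
  -- reordering `ys` of `xs` has the same sum.
  let ys , p , c = multisets⁺ residues (Index.refine 6 ∘ Index.trivial) xs
      zs , ref , cs = lookup-all refutedAtStart (multisets 4 residues) refuted-steps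
        (subst (λ n → Any (Pointwise _ ys) (multisets n residues)) len c)
  in refuted-sound steps 6 1 (Equivalence.from T-≡ periodic-steps) cs (Exponent.trivial k) ref
       (trans (sum-↭ (map⁺ fib p)) eq)

-- Zeckendorf expansions and the small powers.

sum-F≡sum-fib : ∀ L → sum (map F L) ≡ sum (map fib (map (2 +_) L))
sum-F≡sum-fib [] = refl
sum-F≡sum-fib (x ∷ L) = cong₂ _+_ (F≡fib x) (sum-F≡sum-fib L)

zeckLists : ℕ → ℕ → List (List ℕ)
zeckLists zero b = [] ∷ []
zeckLists (suc l) zero = []
-- The bound is strict: after a leading index `b` the next is at most b - 2, hence below `b ∸ 1`.
zeckLists (suc l) (suc b) = zeckLists (suc l) b ++ map (b ∷_) (zeckLists l (b ∸ 1))

zeckLists⁺ : ∀ {a L} b → ZeckIndices (a ∷ L) → a < b → a ∷ L ∈ zeckLists (suc (length L)) b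
zeckLists⁺ {a} (suc b) z a<1+b with a ≟ b
... | no a≢b = ∈-++⁺ˡ (zeckLists⁺ b z (≤∧≢⇒< (≤-pred a<1+b) a≢b))
zeckLists⁺ (suc b) [ _ ] _ | yes refl = ∈-++⁺ʳ (zeckLists 1 b) (here refl)
zeckLists⁺ (suc b) (_∷⟨_⟩_ {c} {L} _ c+2≤b z) _ | yes refl =
  ∈-++⁺ʳ (zeckLists (2 + length L) b) (∈-map⁺ (b ∷_) (zeckLists⁺ (b ∸ 1) z (≤-pred-∸ c+2≤b)))
  where
  ≤-pred-∸ : c + 2 ≤ b → c < b ∸ 1
  ≤-pred-∸ h = ∸-monoˡ-≤ 1 (subst (_≤ b) (+-comm c 2) h)

F-mono-≤ : ∀ {m n} → m ≤ n → F m ≤ F n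
F-mono-≤ {m} m≤n with m≤n⇒∃[o]m+o≡n m≤n
... | o , refl = subst (λ n → F m ≤ F n) (+-comm o m) (shift o)
  where
  step : ∀ n → F n ≤ F (suc n)
  step zero = s≤s z≤n
  step (suc n) = m≤m+n (F (suc n)) (F n)
  shift : ∀ o → F m ≤ F (o + m)
  shift zero = ≤-refl
  shift (suc o) = ≤-trans (shift o) (step (o + m))

small-expansion : ∀ {m L l} → m < 11 → IsZeckendorfExpansion (2 ^ m) L → length L ≡ suc l →
  L ∈ zeckLists (suc l) 15
-- `F 15` is 1597 and exceeds 2 ^ 10 = 1024, so the leading index is at most 14.
small-expansion {m} {a ∷ L} m<11 (zeck z eq) refl = zeckLists⁺ 15 z (≰⇒> λ 15≤a → <⇒≱ F15>2^m (F15≤2^m 15≤a))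
  where
  F15≤2^m : 15 ≤ a → F 15 ≤ 2 ^ m
  F15≤2^m 15≤a = ≤-trans (F-mono-≤ 15≤a) (≤-trans (m≤m+n (F a) _) (≤-reflexive eq))
  F15>2^m : 2 ^ m < F 15
  F15>2^m = ≤-<-trans (^-monoʳ-≤ 2 (≤-pred m<11)) (toWitness {a? = 2 ^ 10 <? F 15} tt)

large-power : ∀ {m} → ¬ m < 11 → ∃ λ k → 2 ^ m ≡ 2048 * 2 ^ k
large-power m≮11 with m≤n⇒∃[o]m+o≡n (≮⇒≥ m≮11)
... | k , refl = k , ^-distribˡ-+-* 2 11 k

Exceptional : ℕ → Set
Exceptional n = n ≡ 32 ⊎ n ≡ 64 ⊎ n ≡ 128 ⊎ n ≡ 256 ⊎ n ≡ 1024

exceptional? : ∀ n → Dec (Exceptional n)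
exceptional? n = (n ≟ 32) ⊎-dec (n ≟ 64) ⊎-dec (n ≟ 128) ⊎-dec (n ≟ 256) ⊎-dec (n ≟ 1024)

small-three : All (λ L → All (λ m → sum (map F L) ≡ 2 ^ m → Exceptional (2 ^ m)) (upTo 11)) (zeckLists 3 15)
small-three = toWitness {a? = All.all? (λ L → All.all? (λ m →
  (sum (map F L) ≟ 2 ^ m) →-dec exceptional? (2 ^ m)) (upTo 11)) (zeckLists 3 15)} tt

small-four : All (λ L → All (λ m → sum (map F L) ≢ 2 ^ m) (upTo 11)) (zeckLists 4 15)
small-four = toWitness {a? = All.all? (λ L → All.all? (λ m →
  ¬? (sum (map F L) ≟ 2 ^ m)) (upTo 11)) (zeckLists 4 15)} tt

-- Three and four summands.

three-summands : ∀ m L → IsZeckendorfExpansion (2 ^ m) L → length L ≡ 3 → Exceptional (2 ^ m)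
three-summands m L e@(zeck _ eq) len with m <? 11
... | yes m<11 = All.lookup (All.lookup small-three (small-expansion m<11 e len)) (∈-upTo⁺ m<11) eq
... | no m≮11 = let k , pow = large-power m≮11 in
  -- fib 0 = 0 serves as the fourth summand.
  ⊥-elim (four-fib≢power (0 ∷ map (2 +_) L) k (cong suc (trans (length-map (2 +_) L) len))
    (trans (sym (sum-F≡sum-fib L)) (trans eq pow)))

four-summands : ∀ m L → IsZeckendorfExpansion (2 ^ m) L → ¬ (length L ≡ 4)
four-summands m L e@(zeck _ eq) len with m <? 11
... | yes m<11 = All.lookup (All.lookup small-four (small-expansion m<11 e len)) (∈-upTo⁺ m<11) eq
... | no m≮11 = let k , pow = large-power m≮11 in
  four-fib≢power (map (2 +_) L) k (trans (length-map (2 +_) L) len)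
    (trans (sym (sum-F≡sum-fib L)) (trans eq pow))

three-term : ∀ a b c {c+2≤b : True (c + 2 ≤? b)} {b+2≤a : True (b + 2 ≤? a)} →
  Σ (List ℕ) (λ L → IsZeckendorfExpansion (sum (map F (a ∷ b ∷ c ∷ []))) L × length L ≡ 3)
three-term a b c {p} {q} =
  _ , zeck (a ∷⟨ toWitness q ⟩ (b ∷⟨ toWitness p ⟩ [ c ])) refl , refl

exceptional-expansion : ∀ {n} → Exceptional n → Σ (List ℕ) (λ L → IsZeckendorfExpansion n L × length L ≡ 3)
-- In order: 21 + 8 + 3, 55 + 8 + 1, 89 + 34 + 5, 233 + 21 + 2 and 987 + 34 + 3.
exceptional-expansion (inj₁ refl) = three-term 6 4 2
exceptional-expansion (inj₂ (inj₁ refl)) = three-term 8 4 0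
exceptional-expansion (inj₂ (inj₂ (inj₁ refl))) = three-term 9 7 3
exceptional-expansion (inj₂ (inj₂ (inj₂ (inj₁ refl)))) = three-term 11 6 1
exceptional-expansion (inj₂ (inj₂ (inj₂ (inj₂ refl)))) = three-term 14 7 2

theorem6 : ((m : ℕ) →
    (Σ (List ℕ) (λ L → IsZeckendorfExpansion (2 ^ m) L × length L ≡ 3))
    ⇔ (2 ^ m ≡ 32 ⊎ 2 ^ m ≡ 64 ⊎ 2 ^ m ≡ 128 ⊎ 2 ^ m ≡ 256 ⊎ 2 ^ m ≡ 1024))
    × ((m : ℕ) (L : List ℕ) → IsZeckendorfExpansion (2 ^ m) L → ¬ (length L ≡ 4))
theorem6 = (λ m → mk⇔ (λ (L , e , len) → three-summands m L e len) exceptional-expansion) , four-summands
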